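{- The following decision problem is undecidable: given a finite set $G$ of matrices in $\mathbb{Z}^{4\times4}$, generating the multiplicative semigroup $S$, and a matrix $M\in S$, decide whether $M$ has more than one factorization over $G$.
   Context: For a finite set $G$ of matrices, $S=\langle G\rangle$ denotes the semigroup of all finite nonempty products of elements of $G$. A factorization of $M\in S$ over $G$ is a finite nonempty sequence $(A_1,\dots,A_t)$ of elements of $G$ with $A_1A_2\cdots A_t=M$; two factorizations are different if they are different sequences. -}

module Defs where

open import Data.Bool using (Bool)
open import Data.Integer using (ℤ; _+_; _*_; 0ℤ)
open import Data.Fin using (Fin)
open import Data.Vec using (Vec; tabulate; lookup; foldr)
open import Data.List using (List; length; concatMap)
import Data.List as List
open import Data.List.NonEmpty using (List⁺; _∷_; toList; foldr₁; map)
open import Data.List.Relation.Unary.All using (All)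
open import Data.List.Membership.Propositional using (_∈_)
open import Data.Product using (Σ; _×_; proj₁; proj₂)
open import Function.Bundles using (_⇔_)
open import Relation.Binary.PropositionalEquality using (_≡_; _≢_)

Mat4 : Set
Mat4 = Vec (Vec ℤ 4) 4

sumℤ : ∀ {n} → Vec ℤ n → ℤ
sumℤ = foldr _ _+_ 0ℤ

_⊗_ : Mat4 → Mat4 → Mat4
A ⊗ B = tabulate λ i → tabulate λ j →
          sumℤ (tabulate λ k → lookup (lookup A i) k * lookup (lookup B k) j)

prod : List⁺ Mat4 → Mat4
prod = foldr₁ _⊗_

IsFactorization : List Mat4 → Mat4 → List⁺ Mat4 → Set
IsFactorization G M fs = All (_∈ G) (toList fs) × prod fs ≡ M

InSemigroup : List Mat4 → Mat4 → Set
InSemigroup G M = Σ (List⁺ Mat4) (IsFactorization G M)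

HasTwoFactorizations : List Mat4 → Mat4 → Set
HasTwoFactorizations G M =
  Σ (List⁺ Mat4) λ f₁ → Σ (List⁺ Mat4) λ f₂ →
    IsFactorization G M f₁ × IsFactorization G M f₂ × f₁ ≢ f₂

PCPInstance : Set
PCPInstance = List (List Bool × List Bool)

PCPSolvable : PCPInstance → Set
PCPSolvable P =
  Σ (List⁺ (Fin (length P))) λ is →
    concatMap (λ i → proj₁ (List.lookup P i)) (toList is)
      ≡ concatMap (λ i → proj₂ (List.lookup P i)) (toList is)

-- Undecidability (synthetic, many-one): a reduction from PCP to the
-- problem.  Every Agda function (under --safe) is computable, so such a
-- function is a computable many-one reduction; since PCP is undecidable,
-- the target problem is undecidable.  The reduction must produce valid
-- inputs, i.e. instances (G , M) with M ∈ ⟨G⟩.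

FactorizationAmbiguityUndecidable : Set
FactorizationAmbiguityUndecidable =
  Σ (PCPInstance → List Mat4 × Mat4) λ f →
    (∀ P → InSemigroup (proj₁ (f P)) (proj₂ (f P)))
    × (∀ P → PCPSolvable P ⇔ HasTwoFactorizations (proj₁ (f P)) (proj₂ (f P)))

-- Write code w for the value of a
-- binary word w in bijective base 3 (digits 1, 2), so code (u ++ w) = code u + 3 ^ |u| * code w
-- and code is injective. The pair (uᵢ, vᵢ) becomes a matrix Wᵢ acting on columns
-- (0, x, y, z) by x ↦ code uᵢ * z + 3 ^ |uᵢ| * x, y ↦ code vᵢ * z + 3 ^ |vᵢ| * y,
-- so Wᵢ₁ ⋯ Wᵢₙ Seed has first column (0, code (uᵢ₁ ⋯ uᵢₙ), code (vᵢ₁ ⋯ vᵢₙ), 1), and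
-- Test turns (0, x, y, z) into 4 (x − y) + 2 z in the corner. Hence Test Wᵢ₁ ⋯ Wᵢₙ Seed is
-- the target (2 in the corner) exactly when i₁ ⋯ iₙ is a solution, the empty sequence
-- giving the factorization Test Seed of every instance.
-- Conversely, following only first columns shows that every other product misses the
-- target: without a final Seed the first column vanishes, and a Seed that is not the
-- last factor produces an even scale z, after which the corner entry is divisible by 4.

module Submission where

open import Defs
open import Data.Bool using (Bool; true; false)
open import Data.Nat as ℕ using (ℕ; zero; suc; _^_; _%_)
import Data.Nat.Properties as ℕ
open import Data.Nat.DivMod using ([m+kn]%n≡m%n)
import Data.Nat.Tactic.RingSolver as ℕ-Solver
open import Data.Integer using (ℤ; +_; -_; _+_; _-_; _*_; 0ℤ; 1ℤ; ∣_∣)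
import Data.Integer.Properties as ℤ
open import Data.Integer.Tactic.RingSolver using (solve-∀)
open import Data.Fin using (Fin)
open import Data.Vec using (Vec; []; _∷_; lookup; tabulate; replicate; map)
open import Data.Vec.Properties using (tabulate-cong; lookup∘tabulate)
open import Data.List as List using (List; []; _∷_; _++_; length; concatMap; allFin)
open import Data.List.NonEmpty as List⁺ using (List⁺; _∷_; _∷⁺_; toList)
open import Data.List.Relation.Unary.All using (All; []; _∷_; universal)
open import Data.List.Relation.Unary.All.Properties using (map⁺)
open import Data.List.Relation.Unary.Any using (here; there)
open import Data.List.Membership.Propositional using (_∈_)
open import Data.List.Membership.Propositional.Properties using (∈-map⁺; ∈-map⁻; ∈-allFin)
open import Data.Product using (∃; _×_; _,_; proj₁; proj₂)
open import Data.Sum using (_⊎_; inj₁; inj₂)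
open import Data.Unit using (⊤; tt)
open import Function using (_∘_)
open import Function.Bundles using (mk⇔)
open import Relation.Nullary using (contradiction)
open import Relation.Binary.PropositionalEquality
  using (_≡_; _≢_; refl; sym; trans; cong; cong₂; module ≡-Reasoning)

-- Matrices acting on their first column

infix 8 _·_
_·_ : ∀ {n} → Vec ℤ n → Vec ℤ n → ℤ
u · v = sumℤ (tabulate λ k → lookup u k * lookup v k)

infixr 7 _*ᵥ_
_*ᵥ_ : Mat4 → Vec ℤ 4 → Vec ℤ 4
X *ᵥ v = tabulate λ i → lookup X i · v

col₀ : Mat4 → Vec ℤ 4
col₀ X = tabulate λ i → lookup (lookup X i) Fin.zero

colMat : Vec ℤ 4 → Mat4
colMat v = tabulate λ i → lookup v i ∷ 0ℤ ∷ 0ℤ ∷ 0ℤ ∷ []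

IsColumn : Mat4 → Set
IsColumn X = X ≡ colMat (col₀ X)

·-zeroʳ : ∀ {n} (u : Vec ℤ n) → u · replicate n 0ℤ ≡ 0ℤ
·-zeroʳ []      = refl
·-zeroʳ (x ∷ u) = cong₂ _+_ (ℤ.*-zeroʳ x) (·-zeroʳ u)

·-unitʳ : ∀ {n} (u : Vec ℤ (suc n)) k → u · (k ∷ replicate n 0ℤ) ≡ lookup u Fin.zero * k
·-unitʳ (x ∷ u) k = trans (cong (_+_ (x * k)) (·-zeroʳ u)) (ℤ.+-identityʳ (x * k))

col₀-⊗ : ∀ X Y → col₀ (X ⊗ Y) ≡ X *ᵥ col₀ Y
col₀-⊗ X Y = refl

⊗-colMat : ∀ X v → X ⊗ colMat v ≡ colMat (X *ᵥ v)
⊗-colMat X v = tabulate-cong λ i →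
  cong₂ _∷_ (sym (lookup∘tabulate (λ i → lookup X i · v) i))
    (cong₂ _∷_ (·-zeroʳ (lookup X i))
      (cong₂ _∷_ (·-zeroʳ (lookup X i)) (cong (_∷ []) (·-zeroʳ (lookup X i)))))

⊗-isColumn : ∀ X {Y} → IsColumn Y → IsColumn (X ⊗ Y)
⊗-isColumn X {Y} Y-column = begin
  X ⊗ Y                ≡⟨ cong (X ⊗_) Y-column ⟩
  X ⊗ colMat (col₀ Y)  ≡⟨ ⊗-colMat X (col₀ Y) ⟩
  colMat (X *ᵥ col₀ Y) ≡⟨ cong colMat (col₀-⊗ X Y) ⟨
  colMat (col₀ (X ⊗ Y)) ∎
  where open ≡-Reasoning

*ᵥ-zeroʳ : ∀ X → X *ᵥ replicate 4 0ℤ ≡ replicate 4 0ℤ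
*ᵥ-zeroʳ X = tabulate-cong {g = λ _ → 0ℤ} λ i → ·-zeroʳ (lookup X i)

*ᵥ-unitʳ : ∀ X k → X *ᵥ (k ∷ replicate 3 0ℤ) ≡ map (_* k) (col₀ X)
*ᵥ-unitʳ X k = tabulate-cong {g = λ i → lookup (lookup X i) Fin.zero * k} λ i →
  ·-unitʳ (lookup X i) k

lower : ℤ → ℤ → ℤ → Vec ℤ 4
lower x y z = 0ℤ ∷ x ∷ y ∷ z ∷ []

top : ℤ → Vec ℤ 4
top k = k ∷ replicate 3 0ℤ

Test : Mat4
Test = (0ℤ ∷ + 4 ∷ - + 4 ∷ + 2 ∷ []) ∷ replicate 3 (replicate 4 0ℤ)

Seed : Mat4
Seed = colMat (lower 0ℤ 0ℤ 1ℤ)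

Affine : ℤ → ℤ → ℤ → ℤ → Mat4
Affine a b c d = replicate 4 0ℤ
  ∷ (0ℤ ∷ a  ∷ 0ℤ ∷ b  ∷ [])
  ∷ (0ℤ ∷ 0ℤ ∷ c  ∷ d  ∷ [])
  ∷ (0ℤ ∷ 0ℤ ∷ 0ℤ ∷ 1ℤ ∷ [])
  ∷ []

target : Mat4
target = colMat (top (+ 2))

testValue : ℤ → ℤ → ℤ → ℤ
testValue x y z = + 4 * (x - y) + + 2 * z

Test*ᵥlower : ∀ x y z → Test *ᵥ lower x y z ≡ top (testValue x y z)
Test*ᵥlower x y z = cong top (row₀ x y z)
  where
  row₀ : ∀ x y z → 0ℤ * 0ℤ + (+ 4 * x + (- + 4 * y + (+ 2 * z + 0ℤ))) ≡ + 4 * (x - y) + + 2 * z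
  row₀ = solve-∀

Affine*ᵥlower : ∀ a b c d x y z →
  Affine a b c d *ᵥ lower x y z ≡ lower (b * z + a * x) (d * z + c * y) z
Affine*ᵥlower a b c d x y z = lower-cong (row₁ a b x y z) (row₂ c d x y z) (row₃ x y z)
  where
  lower-cong : ∀ {x x′ y y′ z z′} → x ≡ x′ → y ≡ y′ → z ≡ z′ → lower x y z ≡ lower x′ y′ z′
  lower-cong refl refl refl = refl
  row₁ : ∀ a b x y z → 0ℤ * 0ℤ + (a * x + (0ℤ * y + (b * z + 0ℤ))) ≡ b * z + a * x
  row₁ = solve-∀
  row₂ : ∀ c d x y z → 0ℤ * 0ℤ + (0ℤ * x + (c * y + (d * z + 0ℤ))) ≡ d * z + c * y
  row₂ = solve-∀
  row₃ : ∀ x y z → 0ℤ * 0ℤ + (0ℤ * x + (0ℤ * y + (1ℤ * z + 0ℤ))) ≡ z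
  row₃ = solve-∀

Seed*ᵥtop : ∀ k → Seed *ᵥ top k ≡ lower 0ℤ 0ℤ k
Seed*ᵥtop k = trans (*ᵥ-unitʳ Seed k) (cong (lower 0ℤ 0ℤ) (ℤ.*-identityˡ k))

-- Encoding binary words in bijective base 3

digit : Bool → ℕ
digit false = 1
digit true  = 2

code : List Bool → ℕ
code []      = 0
code (b ∷ w) = digit b ℕ.+ code w ℕ.* 3

code-++ : ∀ u w → code (u ++ w) ≡ code u ℕ.+ 3 ^ length u ℕ.* code w
code-++ []      w = sym (ℕ.+-identityʳ (code w))
code-++ (b ∷ u) w = trans (cong (λ n → digit b ℕ.+ n ℕ.* 3) (code-++ u w))
                          (shift (digit b) (code u) (3 ^ length u) (code w))
  where
  shift : ∀ d c p n → d ℕ.+ (c ℕ.+ p ℕ.* n) ℕ.* 3 ≡ d ℕ.+ c ℕ.* 3 ℕ.+ 3 ℕ.* p ℕ.* n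
  shift = ℕ-Solver.solve-∀

digit-injective : ∀ {a b} → digit a ≡ digit b → a ≡ b
digit-injective {false} {false} _ = refl
digit-injective {true}  {true}  _ = refl

digit%3 : ∀ b → digit b % 3 ≡ digit b
digit%3 false = refl
digit%3 true  = refl

code-injective : ∀ u w → code u ≡ code w → u ≡ w
code-injective []          []          _  = refl
code-injective []          (false ∷ _) ()
code-injective []          (true ∷ _)  ()
code-injective (false ∷ _) []          ()
code-injective (true ∷ _)  []          ()
code-injective (a ∷ u)     (b ∷ w)     eq =
  cong₂ _∷_ (digit-injective same-digit) (code-injective u w same-rest)
  where
  open ≡-Reasoning
  same-digit : digit a ≡ digit b
  same-digit = begin
    digit a                          ≡⟨ digit%3 a ⟨
    digit a % 3                      ≡⟨ [m+kn]%n≡m%n (digit a) (code u) 3 ⟨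
    (digit a ℕ.+ code u ℕ.* 3) % 3   ≡⟨ cong (_% 3) eq ⟩
    (digit b ℕ.+ code w ℕ.* 3) % 3   ≡⟨ [m+kn]%n≡m%n (digit b) (code w) 3 ⟩
    digit b % 3                      ≡⟨ digit%3 b ⟩
    digit b                          ∎
  same-rest : code u ≡ code w
  same-rest = ℕ.*-cancelʳ-≡ (code u) (code w) 3 (ℕ.+-cancelˡ-≡ (digit a) _ _
    (trans eq (cong (λ d → d ℕ.+ code w ℕ.* 3) (sym same-digit))))

prepend-code : ∀ u w → + code u * 1ℤ + + (3 ^ length u) * + code w ≡ + code (u ++ w)
prepend-code u w = trans (cong₂ _+_ (ℤ.*-identityʳ (+ code u)) (sym (ℤ.pos-* (3 ^ length u) (code w))))
                         (cong +_ (sym (code-++ u w)))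

MultipleOf : ℤ → ℤ → Set
MultipleOf n k = ∃ λ j → k ≡ n * j

testValue-even : ∀ x y j → testValue x y (+ 2 * j) ≡ + 4 * (x - y + j)
testValue-even = identity
  where
  identity : ∀ x y j → + 4 * (x - y) + + 2 * (+ 2 * j) ≡ + 4 * (x - y + j)
  identity = solve-∀

testValue-odd : ∀ x y → testValue x y 1ℤ ≡ + 2 * (+ 2 * (x - y) + 1ℤ)
testValue-odd = identity
  where
  identity : ∀ x y → + 4 * (x - y) + + 2 * 1ℤ ≡ + 2 * (+ 2 * (x - y) + 1ℤ)
  identity = solve-∀

4∣⇒2∣ : ∀ j → + 4 * j ≡ + 2 * (+ 2 * j)
4∣⇒2∣ = solve-∀

testValue-diagonal : ∀ x → testValue x x 1ℤ ≡ + 2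
testValue-diagonal = identity
  where
  identity : ∀ x → + 4 * (x - x) + + 2 * 1ℤ ≡ + 2
  identity = solve-∀

testValue≡2⇒≡ : ∀ x y → testValue x y 1ℤ ≡ + 2 → x ≡ y
testValue≡2⇒≡ x y eq = ℤ.i-j≡0⇒i≡j x y (ℤ.*-cancelˡ-≡ (+ 4) (x - y) 0ℤ 4[x-y]≡0)
  where
  minus-two : ∀ x y → + 4 * (x - y) ≡ (+ 4 * (x - y) + + 2 * 1ℤ) - + 2
  minus-two = solve-∀
  4[x-y]≡0 : + 4 * (x - y) ≡ + 4 * 0ℤ
  4[x-y]≡0 = trans (minus-two x y) (cong (_- + 2) eq)

4*≢2 : ∀ j → + 4 * j ≢ + 2
4*≢2 j eq = n*4≢2 ∣ j ∣ (trans (ℕ.*-comm ∣ j ∣ 4) (trans (sym (ℤ.abs-* (+ 4) j)) (cong ∣_∣ eq)))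
  where
  -- n * 4 rather than 4 * n: ℕ multiplication recurses on its left argument.
  n*4≢2 : ∀ n → n ℕ.* 4 ≢ 2
  n*4≢2 zero    ()
  n*4≢2 (suc n) ()

All-∈-map⁻ : ∀ {A B : Set} {f : A → B} {ys} xs →
  All (_∈ List.map f ys) xs → ∃ λ zs → xs ≡ List.map f zs
All-∈-map⁻ []       []         = [] , refl
All-∈-map⁻ (x ∷ xs) (px ∷ pxs) with ∈-map⁻ _ px | All-∈-map⁻ xs pxs
... | z , _ , refl | zs , refl = z ∷ zs , refl

All⁺-∈-map⁻ : ∀ {A B : Set} {f : A → B} {ys} xs →
  All (_∈ List.map f ys) (toList xs) → ∃ λ zs → xs ≡ List⁺.map f zs
All⁺-∈-map⁻ (x ∷ xs) (px ∷ pxs) with ∈-map⁻ _ px | All-∈-map⁻ xs pxs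
... | z , _ , refl | zs , refl = z ∷ zs , refl

data Column : Set where
  lowerᶜ : ℤ → ℤ → ℤ → Column
  topᶜ   : ℤ → Column
  zeroᶜ  : Column

⟦_⟧ : Column → Vec ℤ 4
⟦ lowerᶜ x y z ⟧ = lower x y z
⟦ topᶜ k ⟧       = top k
⟦ zeroᶜ ⟧        = replicate 4 0ℤ

pairMatrix : List Bool → List Bool → Mat4
pairMatrix u v = Affine (+ (3 ^ length u)) (+ code u) (+ (3 ^ length v)) (+ code v)

module Reduction (P : PCPInstance) where

  m : ℕ
  m = List.length P

  U V : Fin m → List Bool
  U i = proj₁ (List.lookup P i)
  V i = proj₂ (List.lookup P i)

  U* V* : List (Fin m) → List Bool
  U* = concatMap U
  V* = concatMap V

  data Generator : Set where
    test seed : Generator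
    word      : Fin m → Generator

  gen : Generator → Mat4
  gen test     = Test
  gen seed     = Seed
  gen (word i) = pairMatrix (U i) (V i)

  generators : List Generator
  generators = test ∷ seed ∷ List.map word (allFin m)

  G : List Mat4
  G = List.map gen generators

  step : Generator → Column → Column
  step test     (lowerᶜ x y z) = topᶜ (testValue x y z)
  step seed     (topᶜ k)       = lowerᶜ 0ℤ 0ℤ k
  step (word i) (lowerᶜ x y z) =
    lowerᶜ (+ code (U i) * z + + (3 ^ length (U i)) * x) (+ code (V i) * z + + (3 ^ length (V i)) * y) z
  step _        _              = zeroᶜ

  initial : Generator → Column
  initial seed = lowerᶜ 0ℤ 0ℤ 1ℤ
  initial _    = zeroᶜ

  columnOf : List⁺ Generator → Column
  columnOf = List⁺.foldr step initial

  step-sound : ∀ g c → gen g *ᵥ ⟦ c ⟧ ≡ ⟦ step g c ⟧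
  step-sound test     (lowerᶜ x y z) = Test*ᵥlower x y z
  step-sound test     (topᶜ k)       = refl
  step-sound test     zeroᶜ          = *ᵥ-zeroʳ Test
  step-sound seed     (lowerᶜ x y z) = refl
  step-sound seed     (topᶜ k)       = Seed*ᵥtop k
  step-sound seed     zeroᶜ          = *ᵥ-zeroʳ Seed
  step-sound (word i) (lowerᶜ x y z) =
    Affine*ᵥlower (+ (3 ^ length (U i))) (+ code (U i)) (+ (3 ^ length (V i))) (+ code (V i)) x y z
  step-sound (word i) (topᶜ k)       = *ᵥ-unitʳ (gen (word i)) k
  step-sound (word i) zeroᶜ          = *ᵥ-zeroʳ (gen (word i))

  columnOf-sound : ∀ ws → col₀ (prod (List⁺.map gen ws)) ≡ ⟦ columnOf ws ⟧
  columnOf-sound (g ∷ hs) = sound g hs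
    where
    sound : ∀ g hs → col₀ (prod (List⁺.map gen (g ∷ hs))) ≡ ⟦ columnOf (g ∷ hs) ⟧
    sound test     []       = refl
    sound seed     []       = refl
    sound (word i) []       = refl
    sound g        (h ∷ hs) = begin
      col₀ (gen g ⊗ prod (List⁺.map gen (h ∷ hs)))  ≡⟨ col₀-⊗ (gen g) (prod (List⁺.map gen (h ∷ hs))) ⟩
      gen g *ᵥ col₀ (prod (List⁺.map gen (h ∷ hs))) ≡⟨ cong (gen g *ᵥ_) (sound h hs) ⟩
      gen g *ᵥ ⟦ columnOf (h ∷ hs) ⟧                ≡⟨ step-sound g (columnOf (h ∷ hs)) ⟩
      ⟦ step g (columnOf (h ∷ hs)) ⟧                ∎
      where open ≡-Reasoning

  pairWord : List (Fin m) → List⁺ Generator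
  pairWord []       = seed ∷ []
  pairWord (i ∷ is) = word i ∷⁺ pairWord is

  canonicalWord : List (Fin m) → List⁺ Generator
  canonicalWord is = test ∷⁺ pairWord is

  canonical : List (Fin m) → List⁺ Mat4
  canonical is = List⁺.map gen (canonicalWord is)

  columnOf-pairWord : ∀ is → columnOf (pairWord is) ≡ lowerᶜ (+ code (U* is)) (+ code (V* is)) 1ℤ
  columnOf-pairWord []       = refl
  columnOf-pairWord (i ∷ is) = trans (cong (step (word i)) (columnOf-pairWord is))
    (cong₂ (λ x y → lowerᶜ x y 1ℤ) (prepend-code (U i) (U* is)) (prepend-code (V i) (V* is)))

  pairWord-isColumn : ∀ is → IsColumn (prod (List⁺.map gen (pairWord is)))
  pairWord-isColumn []       = refl
  pairWord-isColumn (i ∷ is) = ⊗-isColumn (gen (word i)) (pairWord-isColumn is)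

  canonical-factorization : ∀ is → U* is ≡ V* is → IsFactorization G target (canonical is)
  canonical-factorization is eq = map⁺ (universal generated (toList (canonicalWord is))) , (begin
    prod (canonical is)                                  ≡⟨ ⊗-isColumn Test (pairWord-isColumn is) ⟩
    colMat (col₀ (prod (canonical is)))                  ≡⟨ cong colMat (columnOf-sound (canonicalWord is)) ⟩
    colMat ⟦ step test (columnOf (pairWord is)) ⟧        ≡⟨ cong (λ c → colMat ⟦ step test c ⟧) (columnOf-pairWord is) ⟩
    colMat (top (testValue (+ code (U* is)) (+ code (V* is)) 1ℤ))
      ≡⟨ cong (λ w → colMat (top (testValue (+ code (U* is)) (+ code w) 1ℤ))) eq ⟨
    colMat (top (testValue (+ code (U* is)) (+ code (U* is)) 1ℤ))
      ≡⟨ cong (colMat ∘ top) (testValue-diagonal (+ code (U* is))) ⟩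
    target                                               ∎)
    where
    open ≡-Reasoning
    generated : ∀ g → gen g ∈ G
    generated test     = here refl
    generated seed     = there (here refl)
    generated (word i) = there (there (∈-map⁺ gen (∈-map⁺ word (∈-allFin i))))

  canonical-∷≢[] : ∀ i is → canonical (i ∷ is) ≢ canonical []
  canonical-∷≢[] i is eq = contradiction (cong List⁺.length eq) λ ()

  IsPairWord : List⁺ Generator → ℤ → ℤ → ℤ → Set
  IsPairWord ws x y z = ∃ λ is → ws ≡ pairWord is × x ≡ + code (U* is) × y ≡ + code (V* is) × z ≡ 1ℤ

  IsCanonical : List⁺ Generator → ℤ → Set
  IsCanonical ws k = ∃ λ is → ws ≡ canonicalWord is × k ≡ testValue (+ code (U* is)) (+ code (V* is)) 1ℤ

  Invariant : List⁺ Generator → Column → Set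
  Invariant ws (lowerᶜ x y z) = IsPairWord ws x y z ⊎ MultipleOf (+ 2) z
  Invariant ws (topᶜ k)       = IsCanonical ws k ⊎ MultipleOf (+ 4) k
  Invariant ws zeroᶜ          = ⊤

  invariant-step : ∀ g {ws} c → Invariant ws c → Invariant (g ∷⁺ ws) (step g c)
  invariant-step test (lowerᶜ x y z) (inj₁ (is , refl , refl , refl , refl)) = inj₁ (is , refl , refl)
  invariant-step test (lowerᶜ x y z) (inj₂ (j , refl)) = inj₂ (x - y + j , testValue-even x y j)
  invariant-step seed (topᶜ k) (inj₁ (is , _ , refl)) =
    inj₂ (_ , testValue-odd (+ code (U* is)) (+ code (V* is)))
  invariant-step seed (topᶜ k) (inj₂ (j , refl)) = inj₂ (+ 2 * j , 4∣⇒2∣ j)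
  invariant-step (word i) (lowerᶜ x y z) (inj₁ (is , refl , refl , refl , refl)) =
    inj₁ (i ∷ is , refl , prepend-code (U i) (U* is) , prepend-code (V i) (V* is) , refl)
  invariant-step (word i) (lowerᶜ x y z) (inj₂ z-even) = inj₂ z-even
  invariant-step test     (topᶜ _)         _ = tt
  invariant-step test     zeroᶜ            _ = tt
  invariant-step seed     (lowerᶜ _ _ _)   _ = tt
  invariant-step seed     zeroᶜ            _ = tt
  invariant-step (word _) (topᶜ _)         _ = tt
  invariant-step (word _) zeroᶜ            _ = tt

  invariant : ∀ ws → Invariant ws (columnOf ws)
  invariant (g ∷ hs) = go g hs
    where
    go : ∀ g hs → Invariant (g ∷ hs) (columnOf (g ∷ hs))
    go test     []       = tt
    go seed     []       = inj₁ ([] , refl , refl , refl , refl)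
    go (word i) []       = tt
    go g        (h ∷ hs) = invariant-step g (columnOf (h ∷ hs)) (go h hs)

  column-top2⇒canonical : ∀ ws c → Invariant ws c → ⟦ c ⟧ ≡ top (+ 2) →
    ∃ λ is → ws ≡ canonicalWord is × U* is ≡ V* is
  column-top2⇒canonical ws (lowerᶜ x y z) _ ()
  column-top2⇒canonical ws zeroᶜ          _ ()
  column-top2⇒canonical ws (topᶜ k) (inj₂ (j , refl)) eq =
    contradiction (cong (λ v → lookup v Fin.zero) eq) (4*≢2 j)
  column-top2⇒canonical ws (topᶜ k) (inj₁ (is , ws≡ , refl)) eq = is , ws≡ ,
    code-injective (U* is) (V* is)
      (ℤ.+-injective (testValue≡2⇒≡ _ _ (cong (λ v → lookup v Fin.zero) eq)))

  factorization-canonical : ∀ fs → IsFactorization G target fs →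
    ∃ λ is → fs ≡ canonical is × U* is ≡ V* is
  factorization-canonical fs (generated , prod≡target) with All⁺-∈-map⁻ {f = gen} {ys = generators} fs generated
  ... | ws , refl with column-top2⇒canonical ws (columnOf ws) (invariant ws)
                         (trans (sym (columnOf-sound ws)) (cong col₀ prod≡target))
  ... | is , refl , solution = is , refl , solution

  solvable⇒ambiguous : PCPSolvable P → HasTwoFactorizations G target
  solvable⇒ambiguous (i ∷ is , solution) =
    canonical (i ∷ is) , canonical [] ,
    canonical-factorization (i ∷ is) solution , canonical-factorization [] refl ,
    canonical-∷≢[] i is

  ambiguous⇒solvable : HasTwoFactorizations G target → PCPSolvable P
  ambiguous⇒solvable (f₁ , f₂ , f₁-fact , f₂-fact , f₁≢f₂)
    with factorization-canonical f₁ f₁-fact | factorization-canonical f₂ f₂-fact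
  ... | i ∷ is , _ , solution | _                     = i ∷ is , solution
  ... | []     , refl , _     | i ∷ is , _ , solution = i ∷ is , solution
  ... | []     , refl , _     | []     , refl , _     = contradiction refl f₁≢f₂

open Reduction

theorem5 : FactorizationAmbiguityUndecidable
theorem5 = (λ P → G P , target)
  , (λ P → canonical P [] , canonical-factorization P [] refl)
  , (λ P → mk⇔ (solvable⇒ambiguous P) (ambiguous⇒solvable P))
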